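{- Let $\pi\in S_n$ be a reverse-layered permutation (equivalently, $\pi$ avoids $132$ and $213$ classically). Then \[|\operatorname{SC}_{132}^{ -1}(\pi)|=\sum_{k=0}^n\binom{d_\pi(k)+a_\pi(k)}{k}.\]
   Context: $S_n$ is the set of permutations of $[n]$ in one-line notation. A permutation is reverse-layered if the set of entries of each of its ascending runs (maximal consecutive increasing subsequences) is an interval of consecutive integers. To $\pi=\pi_1\cdots\pi_n$ associate the word $b_1\cdots b_n$ over $\{A,D\}$ with $b_1=A$ and, for $2\le j\le n$, $b_j=A$ if $\pi_{j-1}<\pi_j$ and $b_j=D$ if $\pi_{j-1}>\pi_j$. For $0\le k\le n$, $d_\pi(k)$ is the number of occurrences of $D$ in $b_1\cdots b_k$, and $a_\pi(k)$ is the number of occurrences of $A$ in $b_{k+1}\cdots b_n$ that appear to the right of some occurrence of $D$ in $b_{k+1}\cdots b_n$. Binomial coefficients satisfy $\binom{x}{0}=1$ and $\binom{x}{k}=0$ if $k>x\ge0$. Two sequences of distinct integers have the same relative order if replacing the $i$th smallest entry of each by $i$ yields the same word. $\operatorname{SC}_{132}:S_n\to S_n$ sends a permutation through a stack: at each step, if there is a next input entry and placing it on top of the stack would make the stack contents, read top to bottom, contain no consecutive subsequence with the same relative order as $132$, push it; otherwise pop the top entry of the stack to the end of the output; stop when the output has length $n$. -}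

module Defs where

open import Data.Nat using (ℕ; zero; suc; _+_; _*_; _<_; _≤_; _<ᵇ_)
open import Data.Nat.Properties using (_<?_)
open import Data.Bool using (Bool; true; false; if_then_else_; not; _∧_; _∨_)
open import Data.List using (List; []; _∷_; _++_; [_]; length; map; upTo; drop)
open import Data.Nat.ListAction using (sum)
open import Data.List.Membership.Propositional using (_∈_)
open import Data.List.Relation.Unary.All using (All)
open import Data.List.Relation.Binary.Permutation.Propositional using (_↭_)
open import Data.Nat.Combinatorics using (_C_)

[_]ₙ : ℕ → List ℕ
[ n ]ₙ = map suc (upTo n)

IsPerm : ℕ → List ℕ → Set
IsPerm n σ = σ ↭ [ n ]ₙ

ascRuns : List ℕ → List (List ℕ)
ascRuns [] = []
ascRuns (x ∷ xs) with ascRuns xs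
... | [] = [ x ] ∷ []
... | [] ∷ rs = [ x ] ∷ rs
... | (y ∷ r) ∷ rs = if x <ᵇ y then (x ∷ y ∷ r) ∷ rs else [ x ] ∷ (y ∷ r) ∷ rs

IsInterval : List ℕ → Set
IsInterval xs = ∀ a b m → a ∈ xs → b ∈ xs → a ≤ m → m ≤ b → m ∈ xs

ReverseLayered : List ℕ → Set
ReverseLayered π = All IsInterval (ascRuns π)

data Letter : Set where
  A D : Letter

isD : Letter → Bool
isD A = false
isD D = true

adTail : List ℕ → List Letter
adTail [] = []
adTail (x ∷ []) = []
adTail (x ∷ y ∷ ys) = (if x <ᵇ y then A else D) ∷ adTail (y ∷ ys)

adWord : List ℕ → List Letter
adWord [] = []
adWord (x ∷ xs) = A ∷ adTail (x ∷ xs)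

countD : List Letter → ℕ
countD [] = 0
countD (A ∷ w) = countD w
countD (D ∷ w) = suc (countD w)

countA : List Letter → ℕ
countA [] = 0
countA (A ∷ w) = suc (countA w)
countA (D ∷ w) = countA w

take' : ℕ → List Letter → List Letter
take' zero w = []
take' (suc k) [] = []
take' (suc k) (l ∷ w) = l ∷ take' k w

countAafterD : List Letter → ℕ
countAafterD [] = 0
countAafterD (A ∷ w) = countAafterD w
countAafterD (D ∷ w) = countA w

dπ : List ℕ → ℕ → ℕ
dπ π k = countD (take' k (adWord π))

aπ : List ℕ → ℕ → ℕ
aπ π k = countAafterD (drop k (adWord π))

sum0to : ℕ → (ℕ → ℕ) → ℕ
sum0to n f = sum (map f (upTo (suc n)))

has132 : List ℕ → Bool
has132 [] = false
has132 (a ∷ []) = false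
has132 (a ∷ b ∷ []) = false
has132 (a ∷ b ∷ c ∷ xs) = ((a <ᵇ c) ∧ (c <ᵇ b)) ∨ has132 (b ∷ c ∷ xs)

-- fuel, input, stack (top first), output so far.
-- Each step pushes or pops; with enough fuel it terminates when both
-- input and stack are empty (i.e. output has length n).
scRun : ℕ → List ℕ → List ℕ → List ℕ → List ℕ
scRun zero inp stk out = out
scRun (suc f) [] [] out = out
scRun (suc f) [] (t ∷ stk) out = scRun f [] stk (out ++ [ t ])
scRun (suc f) (x ∷ inp) stk out with has132 (x ∷ stk)
... | false = scRun f inp (x ∷ stk) out
... | true with stk
...   | [] = scRun f inp (x ∷ []) out  -- unreachable: a 1-element stack has no 132
...   | t ∷ stk' = scRun f (x ∷ inp) stk' (out ++ [ t ])

-- 2n steps suffice (n pushes, n pops)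
SC132 : List ℕ → List ℕ
SC132 σ = scRun (2 * length σ) σ [] []

{-# OPTIONS --safe #-}

-- Run the machine backwards: stack and output form a cut of a word. Undoing a
-- push of x deletes x from the top of the stack, after which output entries may
-- return to the stack as long as x < c < b for the last output entry b and the
-- new top c. When π is reverse-layered, this means that x and c lie in one layer
-- and b in an earlier one, so returned entries never permit further returns. If
-- k entries of π have been output when the input is exhausted, the aπ π k
-- ascents x < c in the layers after the cut are therefore the only occasions for
-- these k entries to return, in order, and neighbours may share an occasion
-- exactly when they form a descent: this gives (dπ π k + aπ π k) C k inputs.

module Submission where

open import Defs
open import Data.Bool using (Bool; true; false; if_then_else_; _∧_; _∨_)
open import Data.Bool.Properties using (∨-identityʳ)
open import Data.Nat
open import Data.Nat.Properties
open import Data.Nat.Combinatorics using (_C_; nCn≡1; nCk≡nC[n∸k]; nCk+nC[k+1]≡[n+1]C[k+1]; k>n⇒nCk≡0)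
open import Data.List hiding (sum; _∷ʳ_)
open import Data.List.Properties
open import Data.List.Membership.Propositional using (_∈_)
open import Data.List.Membership.Propositional.Properties
  using (∈-map⁺; ∈-map⁻; ∈-++⁺ˡ; ∈-++⁺ʳ; ∈-++⁻; ∈-concat⁺′; ∈-concat⁻′; ∈-upTo⁺; ∈-upTo⁻)
open import Data.List.Relation.Unary.Any using (here; there)
open import Data.List.Relation.Unary.All as All using (All; []; _∷_)
import Data.List.Relation.Unary.All.Properties as All
open import Data.List.Relation.Unary.AllPairs as AllPairs using (AllPairs; []; _∷_)
import Data.List.Relation.Unary.AllPairs.Properties as AllPairs
open import Data.List.Relation.Unary.Linked as Linked using (Linked; []; [-]; _∷_)
open import Data.List.Relation.Unary.Linked.Properties using (Linked⇒AllPairs)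
open import Data.List.Relation.Unary.Unique.Propositional using (Unique)
import Data.List.Relation.Unary.Unique.Propositional.Properties as Unique
open import Data.List.Relation.Binary.Sublist.Propositional
  using (_⊆_; []; _∷_; _∷ʳ_; ⊆-refl; ⊆-trans; minimum; from∈)
open import Data.List.Relation.Binary.Sublist.Propositional.Properties using (ʳ++⁺; All-resp-⊆)
open import Data.List.Relation.Binary.Permutation.Propositional
  using (_↭_; ↭-refl; ↭-trans; ↭-sym; ↭-reflexive; prep; ↭⇒↭ₛ)
open import Data.List.Relation.Binary.Permutation.Propositional.Properties
  using (↭-length; ↭-reverse; shift)
import Data.List.Relation.Binary.Permutation.Setoid.Properties as Permutationₛ
open import Data.Nat.ListAction using (sum)
open import Data.Product using (Σ; _×_; _,_; proj₁; proj₂; ∃; ∃₂)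
open import Data.Sum using (inj₁; inj₂)
open import Function using (_∘_; flip; id)
open import Function.Bundles using (_⇔_; mk⇔)
open import Relation.Binary.PropositionalEquality hiding ([_])
open import Relation.Nullary using (¬_; contradiction)
open import Relation.Nullary.Reflects using (ofʸ; ofⁿ)

-- The stack machine as a fold over states

-- The stack, top first, and the reversed output.
State : Set
State = List ℕ × List ℕ

blocked : ℕ → List ℕ → Bool
blocked x (b ∷ c ∷ s) = (x <ᵇ c) ∧ (c <ᵇ b)
blocked x _           = false

popWhileBlocked : ℕ → List ℕ → List ℕ → State
popWhileBlocked x []      q = [] , q
popWhileBlocked x (b ∷ s) q =
  if blocked x (b ∷ s) then popWhileBlocked x s (b ∷ q) else (b ∷ s , q)

push : ℕ → State → State
push x (s , q) = let (s′ , q′) = popWhileBlocked x s q in x ∷ s′ , q′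

load : List ℕ → State
load = foldr push ([] , [])

contents : State → List ℕ
contents (s , q) = q ʳ++ s

has132-∷ : ∀ x s → has132 (x ∷ s) ≡ blocked x s ∨ has132 s
has132-∷ x []          = refl
has132-∷ x (b ∷ [])    = refl
has132-∷ x (b ∷ c ∷ s) = refl

-- The push of `x` creates only one new consecutive triple, the top three entries.
has132-∷-avoiding : ∀ x s → has132 s ≡ false → has132 (x ∷ s) ≡ blocked x s
has132-∷-avoiding x s h =
  trans (has132-∷ x s) (trans (cong (blocked x s ∨_) h) (∨-identityʳ _))

has132-tail : ∀ x s → has132 (x ∷ s) ≡ false → has132 s ≡ false
has132-tail x s h with blocked x s | trans (sym (has132-∷ x s)) h
... | false | eq = eq

scRun-[] : ∀ f s q → f ≡ length s → scRun f [] s (reverse q) ≡ q ʳ++ s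
scRun-[] zero    []      q _  = refl
scRun-[] (suc f) (t ∷ s) q eq =
  trans (cong (scRun f [] s) (sym (unfold-reverse t q))) (scRun-[] f s (t ∷ q) (suc-injective eq))

-- The fuel is exactly the number of steps left: a push for each input entry and a pop for each
-- entry of stack or input. The final pops append the stack to the output in order, so the result is
-- the `contents` of the state reached.
scRun≡contents : ∀ f inp s q → has132 s ≡ false → f ≡ length s + 2 * length inp →
  scRun f inp s (reverse q) ≡ contents (foldl (flip push) (s , q) inp)
scRun≡contents f       []        s       q h eq = scRun-[] f s q (trans eq (+-identityʳ _))
scRun≡contents zero    (x ∷ inp) s       q h eq =
  contradiction (sym (m+n≡0⇒n≡0 (length s) (sym eq))) 0≢1+n
scRun≡contents (suc f) (x ∷ inp) []      q h eq =
  scRun≡contents f inp [ x ] q refl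
    (trans (suc-injective eq) (+-suc (length inp) (length inp + 0)))
scRun≡contents (suc f) (x ∷ inp) (t ∷ s) q h eq
  with has132 (x ∷ t ∷ s) in h′ | blocked x (t ∷ s) | has132-∷-avoiding x (t ∷ s) h
... | false | .false | refl =
  scRun≡contents f inp (x ∷ t ∷ s) q h′
    (trans (suc-injective eq)
      (trans (cong (length s +_) (cong suc (+-suc (length inp) _)))
        (trans (+-suc (length s) _) (cong suc (+-suc (length s) _)))))
... | true | .true | refl =
  trans (cong (scRun f (x ∷ inp) s) (sym (unfold-reverse t q)))
    (scRun≡contents f (x ∷ inp) s (t ∷ q) (has132-tail t s h) (suc-injective eq))

SC132≡contents-load : ∀ σ → SC132 σ ≡ contents (load (reverse σ))
SC132≡contents-load σ =
  trans (scRun≡contents (2 * length σ) σ [] [] refl refl)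
    (cong contents (sym (reverse-foldr push ([] , []) σ)))

popWhileBlocked-contents : ∀ x s q → contents (popWhileBlocked x s q) ≡ q ʳ++ s
popWhileBlocked-contents x []      q = refl
popWhileBlocked-contents x (b ∷ s) q with blocked x (b ∷ s)
... | true  = popWhileBlocked-contents x s (b ∷ q)
... | false = refl

load-↭ : ∀ ρ → contents (load ρ) ↭ ρ
load-↭ []      = ↭-refl
load-↭ (x ∷ ρ) = let (s , q) = load ρ ; (s′ , q′) = popWhileBlocked x s q in
  ↭-trans (↭-reflexive (ʳ++-defn q′))
    (↭-trans (shift x (reverse q′) s′)
      (prep x (↭-trans (↭-reflexive (trans (sym (ʳ++-defn q′)) (popWhileBlocked-contents x s q)))
        (load-↭ ρ))))

-- Running the machine backwards

mutual

  -- The reversed inputs of length n that lead to the state (s , q).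
  inputs : ℕ → List ℕ → List ℕ → List (List ℕ)
  inputs zero    []      []      = [ [] ]
  inputs zero    []      (_ ∷ _) = []
  inputs zero    (_ ∷ _) _       = []
  inputs (suc n) []      q       = []
  inputs (suc n) (x ∷ s) q       =
    if blocked x s then [] else map (x ∷_) (inputsBefore n x s q)

  -- The reversed inputs of length n that lead to a state from which
  -- zero or more pops, each forced by x, lead to (s , q).
  inputsBefore : ℕ → ℕ → List ℕ → List ℕ → List (List ℕ)
  inputsBefore n x s []      = inputs n s []
  inputsBefore n x s (b ∷ q) =
    inputs n s (b ∷ q) ++ (if blocked x (b ∷ s) then inputsBefore n x (b ∷ s) q else [])

popWhileBlocked-unblocked : ∀ x s q → blocked x s ≡ false → popWhileBlocked x s q ≡ (s , q)
popWhileBlocked-unblocked x []      q _ = refl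
popWhileBlocked-unblocked x (b ∷ s) q u rewrite u = refl

mutual

  inputs-sound : ∀ n s q {ρ} → ρ ∈ inputs n s q → load ρ ≡ (s , q)
  inputs-sound zero    []      [] (here refl) = refl
  inputs-sound (suc n) (x ∷ s) q  ρ∈ with blocked x s in u
  ... | false with ∈-map⁻ (x ∷_) ρ∈
  ...   | ρ , ρ∈′ , refl =
    cong (λ (s , q) → x ∷ s , q)
      (trans (inputsBefore-sound n x s q ρ∈′) (popWhileBlocked-unblocked x s q u))

  -- Both sides pop to the end because along the recursion `x` may still be blocked at `(s , q)`.
  -- Where `inputs` has tested that it is not, `popWhileBlocked-unblocked` recovers `(s , q)`
  -- itself.
  inputsBefore-sound : ∀ n x s q {ρ} → ρ ∈ inputsBefore n x s q →
    (let (s₀ , q₀) = load ρ in popWhileBlocked x s₀ q₀) ≡ popWhileBlocked x s q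
  inputsBefore-sound n x s []      ρ∈ rewrite inputs-sound n s [] ρ∈ = refl
  inputsBefore-sound n x s (b ∷ q) ρ∈ with ∈-++⁻ (inputs n s (b ∷ q)) ρ∈
  ... | inj₁ ρ∈′ rewrite inputs-sound n s (b ∷ q) ρ∈′ = refl
  ... | inj₂ ρ∈′ with blocked x (b ∷ s) in u
  ...   | true = trans (inputsBefore-sound n x (b ∷ s) q ρ∈′) 
    (cong (if_then popWhileBlocked x s (b ∷ q) else (b ∷ s , q)) u)

inputs⊆inputsBefore : ∀ n x s q {ρ} → ρ ∈ inputs n s q → ρ ∈ inputsBefore n x s q
inputs⊆inputsBefore n x s []      ρ∈ = ρ∈
inputs⊆inputsBefore n x s (b ∷ q) ρ∈ = ∈-++⁺ˡ ρ∈

-- Every pop made here is forced by `x`, hence is one that `inputsBefore` undoes. Started from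
-- `load ρ`, this places `ρ` in the list of the state where the pops stop.
inputsBefore-popWhileBlocked : ∀ n x s q {ρ} → ρ ∈ inputsBefore n x s q →
  let (s′ , q′) = popWhileBlocked x s q in ρ ∈ inputsBefore n x s′ q′
inputsBefore-popWhileBlocked n x []      q ρ∈ = ρ∈
inputsBefore-popWhileBlocked n x (b ∷ s) q {ρ} ρ∈ with blocked x (b ∷ s) in u
... | false = ρ∈
... | true  = inputsBefore-popWhileBlocked n x s (b ∷ q)
  (∈-++⁺ʳ (inputs n s (b ∷ q)) 
    (subst (λ β → ρ ∈ (if β then inputsBefore n x (b ∷ s) q else [])) (sym u) ρ∈))

popWhileBlocked-stops : ∀ x s q → blocked x (proj₁ (popWhileBlocked x s q)) ≡ false
popWhileBlocked-stops x []      q = refl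
popWhileBlocked-stops x (b ∷ s) q with blocked x (b ∷ s) in u
... | true  = popWhileBlocked-stops x s (b ∷ q)
... | false = u

inputs-complete : ∀ ρ → let (s , q) = load ρ in ρ ∈ inputs (length ρ) s q
inputs-complete []      = here refl
inputs-complete (x ∷ ρ)
  -- `x` is pushed only when unblocked, so the test in `inputs` takes its `else` branch.
  rewrite (let (s , q) = load ρ in popWhileBlocked-stops x s q) =
  let (s , q) = load ρ in
  ∈-map⁺ (x ∷_) (inputsBefore-popWhileBlocked (length ρ) x s q
    (inputs⊆inputsBefore (length ρ) x s q (inputs-complete ρ)))

-- Undoing pops can only shorten the output; this separates the two lists joined in `inputsBefore`.
inputsBefore-output : ∀ n x s q {ρ} → ρ ∈ inputsBefore n x s q →
  length (proj₂ (load ρ)) ≤ length q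
inputsBefore-output n x s []      ρ∈ rewrite inputs-sound n s [] ρ∈ = ≤-refl
inputsBefore-output n x s (b ∷ q) ρ∈ with ∈-++⁻ (inputs n s (b ∷ q)) ρ∈
... | inj₁ ρ∈′ rewrite inputs-sound n s (b ∷ q) ρ∈′ = ≤-refl
... | inj₂ ρ∈′ with blocked x (b ∷ s)
...   | true = m≤n⇒m≤1+n (inputsBefore-output n x (b ∷ s) q ρ∈′)

mutual

  inputs-unique : ∀ n s q → Unique (inputs n s q)
  inputs-unique zero    []      []      = [] ∷ []
  inputs-unique zero    []      (_ ∷ _) = []
  inputs-unique zero    (_ ∷ _) q       = []
  inputs-unique (suc n) []      q       = []
  inputs-unique (suc n) (x ∷ s) q with blocked x s
  ... | true  = []
  ... | false = Unique.map⁺ ∷-injectiveʳ (inputsBefore-unique n x s q)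

  inputsBefore-unique : ∀ n x s q → Unique (inputsBefore n x s q)
  inputsBefore-unique n x s []      = inputs-unique n s []
  inputsBefore-unique n x s (b ∷ q) with blocked x (b ∷ s)
  ... | false = Unique.++⁺ (inputs-unique n s (b ∷ q)) [] λ ()
  ... | true  = Unique.++⁺ (inputs-unique n s (b ∷ q)) (inputsBefore-unique n x (b ∷ s) q)
    -- A common member would leave an output of length `suc (length q)` by the first list and at
    -- most `length q` by the second.
    λ (ρ∈ , ρ∈′) → 1+n≰n (subst (λ st → length (proj₂ st) ≤ length q)
      (inputs-sound n s (b ∷ q) ρ∈) (inputsBefore-output n x (b ∷ s) q ρ∈′))

-- Reverse-layered words by pattern avoidance

-- Avoidance of 132 and 213 among distinct entries. Unlike the interval condition on runs, it passes
-- to sublists, and undoing a push deletes an entry.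
record Layered (π : List ℕ) : Set where
  field
    distinct   : ∀ {a b} → a ∷ b ∷ [] ⊆ π → a ≢ b
    increasing : ∀ {a b c} → a ∷ b ∷ c ∷ [] ⊆ π → a ≤ c → a < b × b < c

open Layered

Layered-⊆ : ∀ {π ρ} → ρ ⊆ π → Layered π → Layered ρ
Layered-⊆ ρ⊆π L .distinct   ⊆ρ = distinct L (⊆-trans ⊆ρ ρ⊆π)
Layered-⊆ ρ⊆π L .increasing ⊆ρ = increasing L (⊆-trans ⊆ρ ρ⊆π)

⊆-ʳ++ : ∀ {ys zs : List ℕ} q → ys ⊆ zs → ys ⊆ q ʳ++ zs
⊆-ʳ++ q = ʳ++⁺ (minimum q)

Layered-drop : ∀ q {x s} → Layered (q ʳ++ (x ∷ s)) → Layered (q ʳ++ s)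
Layered-drop q = Layered-⊆ (ʳ++⁺ (⊆-refl {x = q}) (_ ∷ʳ ⊆-refl))

Layered⇒unblocked : ∀ x s → Layered (x ∷ s) → blocked x s ≡ false
Layered⇒unblocked x []          L = refl
Layered⇒unblocked x (b ∷ [])    L = refl
Layered⇒unblocked x (b ∷ c ∷ s) L
  with x <ᵇ c | <ᵇ-reflects-< x c | c <ᵇ b | <ᵇ-reflects-< c b
... | false | _       | _     | _       = refl
... | true  | _       | false | _       = refl
... | true  | ofʸ x<c | true  | ofʸ c<b =
  contradiction c<b (<-asym (proj₂ (increasing L (refl ∷ refl ∷ refl ∷ minimum s) (<⇒≤ x<c))))

-- Counting the inputs that lead to a given state

-- The argument is a reversed output: `b′` precedes `b` in `π`, so these are the descents of `π`
-- before the cut.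
descents : List ℕ → ℕ
descents []           = 0
descents (b ∷ [])     = 0
descents (b ∷ b′ ∷ q) = (if b′ <ᵇ b then 0 else 1) + descents (b′ ∷ q)

descents≤ : ∀ b q → descents (b ∷ q) ≤ length q
descents≤ b []       = z≤n
descents≤ b (b′ ∷ q) with b′ <ᵇ b
... | true  = m≤n⇒m≤1+n (descents≤ b′ q)
... | false = s≤s (descents≤ b′ q)

-- The positions of s whose entry forces b off the stack once
-- the entries of s before it have been removed.
gates : ℕ → List ℕ → ℕ
gates b []      = 0
gates b (x ∷ s) = (if blocked x (b ∷ s) then 1 else 0) + gates b s

gates-cong : ∀ {b b′} x s → (∀ {c} → c ∈ s → (c <ᵇ b) ≡ (c <ᵇ b′)) →
  gates b (x ∷ s) ≡ gates b′ (x ∷ s)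
gates-cong x []      _  = refl
gates-cong x (c ∷ s) eq = cong₂ _+_
  (cong (λ β → if (x <ᵇ c) ∧ β then 1 else 0) (eq (here refl)))
  (gates-cong c s (eq ∘ there))

<ᵇ-cong : ∀ {m n m′ n′} → (m < n → m′ < n′) → (m′ < n′ → m < n) → (m <ᵇ n) ≡ (m′ <ᵇ n′)
<ᵇ-cong {m} {n} {m′} {n′} f g
  with m <ᵇ n | <ᵇ-reflects-< m n | m′ <ᵇ n′ | <ᵇ-reflects-< m′ n′
... | true  | _       | true  | _       = refl
... | false | _       | false | _       = refl
... | true  | ofʸ p   | false | ofⁿ ¬p  = contradiction (f p) ¬p
... | false | ofⁿ ¬p  | true  | ofʸ p   = contradiction (g p) ¬p

-- An entry of s between b and b′ would lie in the layer of b, hence so would c.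
gates-shift : ∀ {b b′} c s → Layered (b′ ∷ b ∷ c ∷ s) → c < b →
  gates b′ (b ∷ c ∷ s) ≡ gates b (c ∷ s)
gates-shift {b} {b′} c s L c<b with b <ᵇ c | <ᵇ-reflects-< b c
... | true  | ofʸ b<c = contradiction b<c (<-asym c<b)
... | false | _       = gates-cong c s λ d∈s → <ᵇ-cong
  (λ d<b′ → ≰⇒> λ b≤d →
    <-asym c<b (proj₁ (increasing L (b′ ∷ʳ refl ∷ refl ∷ from∈ d∈s) b≤d)))
  (λ d<b → ≰⇒> λ b′≤d →
    <-asym d<b (proj₂ (increasing L (refl ∷ refl ∷ c ∷ʳ from∈ d∈s) b′≤d)))

nC0≡1 : ∀ n → n C 0 ≡ 1
nC0≡1 n = trans (nCk≡nC[n∸k] {n = n} z≤n) (nCn≡1 n)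

length-inputs-[] : ∀ s → Layered s → length (inputs (length s) s []) ≡ 1
length-inputs-[] []      L = refl
length-inputs-[] (x ∷ s) L rewrite Layered⇒unblocked x s L =
  trans (length-map (x ∷_) (inputs (length s) s [])) (length-inputs-[] s (Layered-⊆ (x ∷ʳ ⊆-refl) L))

mutual

  length-inputs : ∀ n s b q → Layered ((b ∷ q) ʳ++ s) → n ≡ length s + length (b ∷ q) →
    length (inputs n s (b ∷ q)) ≡ (descents (b ∷ q) + gates b s) C suc (length q)
  length-inputs (suc n) [] b q L eq =
    -- A push leaves the stack nonempty, so no input leads here; the binomial vanishes too, as
    -- `b ∷ q` has at most `length q` descents.
    sym (k>n⇒nCk≡0 (s≤s (subst (_≤ length q) (sym (+-identityʳ _)) (descents≤ b q))))
  length-inputs (suc n) (x ∷ s) b q L eq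
    rewrite Layered⇒unblocked x s (Layered-⊆ (⊆-ʳ++ (b ∷ q) ⊆-refl) L) =
    trans (length-map (x ∷_) (inputsBefore n x s (b ∷ q)))
      (length-inputsBefore n x s b q (Layered-drop (b ∷ q) L) (suc-injective eq))

  -- A gate can release nothing or one more entry, whence Pascal's rule.
  length-inputsBefore : ∀ n x s b q → Layered ((b ∷ q) ʳ++ s) → n ≡ length s + length (b ∷ q) →
    length (inputsBefore n x s (b ∷ q)) ≡
      (descents (b ∷ q) + gates b (x ∷ s)) C suc (length q)
  length-inputsBefore n x s b q L eq with blocked x (b ∷ s) in u
  ... | false = trans (cong length (++-identityʳ (inputs n s (b ∷ q)))) (length-inputs n s b q L eq)
  length-inputsBefore n x (c ∷ s) b q L eq | true with c <ᵇ b | <ᵇ-reflects-< c b | x <ᵇ c | <ᵇ-reflects-< x c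
  ... | true | ofʸ c<b | true | ofʸ x<c = begin
    length (inputs n (c ∷ s) (b ∷ q) ++ inputsBefore n x (b ∷ c ∷ s) q)
      ≡⟨ length-++ (inputs n (c ∷ s) (b ∷ q)) ⟩
    length (inputs n (c ∷ s) (b ∷ q)) + length (inputsBefore n x (b ∷ c ∷ s) q)
      ≡⟨ cong₂ _+_ (length-inputs n (c ∷ s) b q L eq)
           (length-released n x c s b q L (<-trans x<c c<b) c<b 
             (trans eq (cong suc (+-suc (length s) (length q))))) ⟩
    N C suc (length q) + N C length q
      ≡⟨ +-comm (N C suc (length q)) _ ⟩
    N C length q + N C suc (length q)
      ≡⟨ nCk+nC[k+1]≡[n+1]C[k+1] N (length q) ⟩
    suc N C suc (length q)
      ≡⟨ cong (_C suc (length q)) (sym (+-suc (descents (b ∷ q)) _)) ⟩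
    (descents (b ∷ q) + suc (gates b (c ∷ s))) C suc (length q) ∎
    where
    open ≡-Reasoning
    N = descents (b ∷ q) + gates b (c ∷ s)

  -- Once `b` is back on the stack, `x < b` makes `x` release `b′` as well exactly when `b < b′`.
  -- This shared gate is the contribution of the pair to `descents (b ∷ b′ ∷ q)`. By `gates-shift`
  -- the later gates serve `b′` as they serve `b`, so the upper index is kept while one entry fewer
  -- remains to be released.
  length-released : ∀ n x c s b q → Layered ((b ∷ q) ʳ++ c ∷ s) → x < b → c < b →
    n ≡ length (b ∷ c ∷ s) + length q →
    length (inputsBefore n x (b ∷ c ∷ s) q) ≡ (descents (b ∷ q) + gates b (c ∷ s)) C length q
  length-released n x c s b []       L x<b c<b eq rewrite trans eq (+-identityʳ _) =
    trans (length-inputs-[] (b ∷ c ∷ s) L) (sym (nC0≡1 (gates b (c ∷ s))))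
  length-released n x c s b (b′ ∷ q) L x<b c<b eq =
    trans (length-inputsBefore n x (b ∷ c ∷ s) b′ q L eq)
      (cong (_C suc (length q)) (begin
        descents (b′ ∷ q) + (released + gates b′ (b ∷ c ∷ s))
          ≡⟨ +-assoc (descents (b′ ∷ q)) released _ ⟨
        descents (b′ ∷ q) + released + gates b′ (b ∷ c ∷ s)
          ≡⟨ cong₂ _+_ (trans (+-comm _ released) (cong (_+ descents (b′ ∷ q)) released≡))
               (gates-shift c s L′ c<b) ⟩
        descents (b ∷ b′ ∷ q) + gates b (c ∷ s) ∎))
    where
    open ≡-Reasoning
    released = if blocked x (b′ ∷ b ∷ c ∷ s) then 1 else 0
    L′ : Layered (b′ ∷ b ∷ c ∷ s)
    L′ = Layered-⊆ (⊆-ʳ++ q ⊆-refl) L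
    released≡ : released ≡ (if b′ <ᵇ b then 0 else 1)
    released≡ with x <ᵇ b | <ᵇ-reflects-< x b | b <ᵇ b′ | <ᵇ-reflects-< b b′ | b′ <ᵇ b | <ᵇ-reflects-< b′ b
    ... | false | ofⁿ x≮b | _     | _        | _     | _        = contradiction x<b x≮b
    ... | true  | _       | true  | ofʸ b<b′ | true  | ofʸ b′<b = contradiction b<b′ (<-asym b′<b)
    ... | true  | _       | true  | _        | false | _        = refl
    ... | true  | _       | false | _        | true  | _        = refl
    ... | true  | _       | false | ofⁿ b≮b′ | false | ofⁿ b′≮b =
      contradiction (≤-antisym (≮⇒≥ b≮b′) (≮⇒≥ b′≮b)) (distinct L′ (refl ∷ refl ∷ minimum _))

-- Descents and gates read off the word in `A` and `D`

countD-++ : ∀ v w → countD (v ++ w) ≡ countD v + countD w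
countD-++ []      w = refl
countD-++ (A ∷ v) w = countD-++ v w
countD-++ (D ∷ v) w = cong suc (countD-++ v w)

take′-++ : ∀ v w → take' (length v) (v ++ w) ≡ v
take′-++ []      w = refl
take′-++ (l ∷ v) w = cong (l ∷_) (take′-++ v w)

module _ {ℓ} {X : Set ℓ} where

  take-++ : ∀ (v w : List X) → take (length v) (v ++ w) ≡ v
  take-++ []      w = refl
  take-++ (x ∷ v) w = cong (x ∷_) (take-++ v w)

  drop-++ : ∀ (v w : List X) → drop (length v) (v ++ w) ≡ w
  drop-++ []      w = refl
  drop-++ (x ∷ v) w = drop-++ v w

-- The initial `A` gives every entry before the cut one letter, so `w` ends with the letter of `b`,
-- and the comparison across the cut belongs to `adTail (b ∷ s)`.
adWord-ʳ++ : ∀ b q s → ∃ λ w → adWord ((b ∷ q) ʳ++ s) ≡ w ++ adTail (b ∷ s)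
  × length w ≡ suc (length q) × countD w ≡ descents (b ∷ q)
adWord-ʳ++ b []       s = [ A ] , refl , refl , refl
adWord-ʳ++ b (b′ ∷ q) s with adWord-ʳ++ b′ q (b ∷ s)
... | w , word≡ , length≡ , countD≡ =
    w ++ [ l ]
  , trans word≡ (sym (++-assoc w [ l ] (adTail (b ∷ s))))
  , trans (length-++ w) (trans (+-comm (length w) 1) (cong suc length≡))
  , trans (countD-++ w [ l ]) (trans (+-comm (countD w) _) (cong₂ _+_ countD-l countD≡))
  where
  l = if b′ <ᵇ b then A else D
  countD-l : countD [ l ] ≡ (if b′ <ᵇ b then 0 else 1)
  countD-l with b′ <ᵇ b
  ... | true  = refl
  ... | false = refl

countA-adTail : ∀ b x s → (∀ {c} → c ∈ s → c < b) → countA (adTail (x ∷ s)) ≡ gates b (x ∷ s)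
countA-adTail b x []      _  = refl
countA-adTail b x (c ∷ s) <b with c <ᵇ b | <ᵇ-reflects-< c b | x <ᵇ c
... | false | ofⁿ c≮b | _     = contradiction (<b (here refl)) c≮b
... | true  | _       | true  = cong suc (countA-adTail b c s (<b ∘ there))
... | true  | _       | false = countA-adTail b c s (<b ∘ there)

-- While the run of `b` continues, its entries exceed `b` and yield no gate. From the first descent
-- on, all entries are below `b`, and gates are just ascents.
countAafterD-adTail : ∀ b s → Layered (b ∷ s) → countAafterD (adTail (b ∷ s)) ≡ gates b s
countAafterD-adTail b []      L = refl
countAafterD-adTail b (x ∷ s) L with b <ᵇ x | <ᵇ-reflects-< b x
... | false | ofⁿ b≮x = countA-adTail b x s λ c∈s → ≰⇒> λ b≤c →
  b≮x (proj₁ (increasing L (refl ∷ refl ∷ from∈ c∈s) b≤c))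
countAafterD-adTail b (x ∷ [])    L | true | ofʸ b<x = refl
countAafterD-adTail b (x ∷ c ∷ s) L | true | ofʸ b<x =
  trans (countAafterD-adTail x (c ∷ s) (Layered-⊆ (b ∷ʳ ⊆-refl) L))
    (cong₂ _+_ (cong (if_then 1 else 0) (sym unblocked))
      -- The induction replaced `b` by the next entry `x` of its run; no later entry lies between
      -- the two.
      (gates-cong c s λ d∈s → <ᵇ-cong
        (λ d<x → ≰⇒> λ b≤d →
          <-asym d<x (proj₂ (increasing L (refl ∷ refl ∷ c ∷ʳ from∈ d∈s) b≤d)))
        (λ d<b → <-trans d<b b<x)))
  where
  unblocked : blocked x (b ∷ c ∷ s) ≡ false
  unblocked with x <ᵇ c | <ᵇ-reflects-< x c | c <ᵇ b | <ᵇ-reflects-< c b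
  ... | false | _       | _     | _       = refl
  ... | true  | _       | false | _       = refl
  ... | true  | ofʸ x<c | true  | ofʸ c<b =
    contradiction (<-trans c<b b<x) (<-asym x<c)

length-inputs-cut : ∀ q s → Layered (q ʳ++ s) → let π = q ʳ++ s in
  length (inputs (length π) s q) ≡ (dπ π (length q) + aπ π (length q)) C length q
length-inputs-cut []      s L = trans (length-inputs-[] s L) (sym (nC0≡1 (aπ s 0)))
length-inputs-cut (b ∷ q) s L with adWord-ʳ++ b q s
... | w , word≡ , length≡ , countD≡ rewrite word≡ | sym length≡ | take′-++ w (adTail (b ∷ s))
                                          | drop-++ w (adTail (b ∷ s)) | countD≡
                                          | countAafterD-adTail b s (Layered-⊆ (⊆-ʳ++ q ⊆-refl) L)
                                          | length≡ =
  length-inputs (length ((b ∷ q) ʳ++ s)) s b q L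
    (trans (length-ʳ++ (b ∷ q)) (+-comm (length (b ∷ q)) (length s)))

-- From interval runs to pattern avoidance

concat-ascRuns : ∀ xs → concat (ascRuns xs) ≡ xs
concat-ascRuns []       = refl
concat-ascRuns (x ∷ xs) with ascRuns xs | concat-ascRuns xs
... | []           | refl = refl
... | [] ∷ rs      | eq   = cong (x ∷_) eq
... | (y ∷ r) ∷ rs | eq with x <ᵇ y
...   | true  = cong (x ∷_) eq
...   | false = cong (x ∷_) eq

ascRuns-increasing : ∀ xs → All (Linked _<_) (ascRuns xs)
ascRuns-increasing []       = []
ascRuns-increasing (x ∷ xs) with ascRuns xs | ascRuns-increasing xs
... | []           | []        = [-] ∷ []
... | [] ∷ rs      | _ ∷ inc   = [-] ∷ inc
... | (y ∷ r) ∷ rs | i ∷ inc with x <ᵇ y | <ᵇ-reflects-< x y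
...   | true  | ofʸ x<y = (x<y ∷ i) ∷ inc
...   | false | _       = [-] ∷ i ∷ inc

-- Arbitrary members serve as witnesses, so they survive when an entry is prepended to `r`; they
-- also show both runs nonempty.
Descend : List ℕ → List ℕ → Set
Descend r r′ = ∃₂ λ y z → y ∈ r × z ∈ r′ × z < y

ascRuns-descend : ∀ xs → Unique xs → Linked Descend (ascRuns xs)
ascRuns-descend []       _        = []
ascRuns-descend (x ∷ xs) (x∉ ∷ u) with ascRuns xs | ascRuns-descend xs u | concat-ascRuns xs
... | []                | _  | _    = [-]
... | [] ∷ []           | _  | _    = [-]
... | [] ∷ _ ∷ _        | (_ , _ , () , _) ∷ _ | _
... | (y ∷ r) ∷ rs      | d  | refl with x <ᵇ y | <ᵇ-reflects-< x y
...   | false | ofⁿ x≮y =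
  (x , y , here refl , here refl , ≤∧≢⇒< (≮⇒≥ x≮y) (≢-sym (All.head x∉))) ∷ d
ascRuns-descend (x ∷ xs) _ | (y ∷ r) ∷ []     | _                                | refl
      | true  | _       = [-]
ascRuns-descend (x ∷ xs) _ | (y ∷ r) ∷ _ ∷ _ | (u , v , u∈ , v∈ , v<u) ∷ d | refl
      | true  | _       = (u , v , there u∈ , v∈ , v<u) ∷ d

infix 4 _≫_

_≫_ : List ℕ → List ℕ → Set
r ≫ s = All (λ u → All (_< u) s) r

-- If u < v with u in r and v in r′, one of the two intervals
-- contains an element of the other.
descend⇒≫ : ∀ r r′ → IsInterval r → IsInterval r′ → All (λ u → All (u ≢_) r′) r →
  Descend r r′ → r ≫ r′
descend⇒≫ r r′ I I′ disj (y , z , y∈ , z∈ , z<y) =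
  All.tabulate λ {u} u∈ → All.tabulate λ {v} v∈ → ≰⇒> λ u≤v → impossible u∈ v∈ u≤v
  where
  apart : ∀ {u} → u ∈ r → ¬ u ∈ r′
  apart u∈ u∈′ = All.lookup (All.lookup disj u∈) u∈′ refl
  impossible : ∀ {u v} → u ∈ r → v ∈ r′ → ¬ u ≤ v
  impossible {u} {v} u∈ v∈ u≤v with ≤-total u z
  ... | inj₁ u≤z = apart (I u y z u∈ y∈ u≤z (<⇒≤ z<y)) z∈
  ... | inj₂ z≤u = apart u∈ (I′ z v u z∈ v∈ z≤u u≤v)

module _ {a ℓ} {X : Set a} {R : X → X → Set ℓ} where

  AllPairs-++⁻ : ∀ xs {ys} → AllPairs R (xs ++ ys) → All (λ x → All (R x) ys) xs × AllPairs R ys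
  AllPairs-++⁻ []       ps       = [] , ps
  AllPairs-++⁻ (x ∷ xs) (p ∷ ps) =
    let (cross , ps′) = AllPairs-++⁻ xs ps in All.++⁻ʳ xs p ∷ cross , ps′

  AllPairs-lookup : ∀ {xs x y} → AllPairs R xs → x ∷ y ∷ [] ⊆ xs → R x y
  AllPairs-lookup (_ ∷ ps) (_ ∷ʳ xy⊆)  = AllPairs-lookup ps xy⊆
  AllPairs-lookup (p ∷ _)  (refl ∷ y⊆) = All.head (All-resp-⊆ y⊆ p)

module _ {a ℓ} {X : Set a} {P : X → Set ℓ} where

  All⇒AllPairsˡ : ∀ {xs} → All P xs → AllPairs (λ x _ → P x) xs
  All⇒AllPairsˡ []       = []
  All⇒AllPairsˡ (p ∷ ps) = All.tabulate (λ _ → p) ∷ All⇒AllPairsˡ ps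

  All⇒AllPairsʳ : ∀ {xs} → All P xs → AllPairs (λ _ y → P y) xs
  All⇒AllPairsʳ []       = []
  All⇒AllPairsʳ (p ∷ ps) = ps ∷ All⇒AllPairsʳ ps

-- Adjacent runs are compared by `descend⇒≫`. Transitivity to later runs passes through the member
-- `z` of `r′` that the descent supplies.
≫-concat : ∀ r rs → Linked Descend (r ∷ rs) → All IsInterval (r ∷ rs) →
  Unique (concat (r ∷ rs)) → r ≫ concat rs
≫-concat r []        _       _             _ = All.tabulate λ _ → []
≫-concat r (r′ ∷ rs) (d ∷ l) (I ∷ I′ ∷ Is) u =
  let (disj , u′)         = AllPairs-++⁻ r u
      r≫r′                = descend⇒≫ r r′ I I′ (All.map (All.++⁻ˡ r′) disj) d
      r′≫rs               = ≫-concat r′ rs l (I′ ∷ Is) u′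
      (_ , z , _ , z∈ , _) = d
  in All.map (λ r′<u → All.++⁺ r′<u
       (All.map (λ v<z → <-trans v<z (All.lookup r′<u z∈)) (All.lookup r′≫rs z∈))) r≫r′

-- A triple that starts in `r` and ends no lower cannot end in `s`, so it lies inside the increasing
-- list `r`.
Layered-++ : ∀ r s → AllPairs _<_ r → r ≫ s → Layered s → Layered (r ++ s)
Layered-++ []      s _           _           L = L
Layered-++ (x ∷ r) s (x<r ∷ inc) (s<x ∷ r≫s) L = L″
  where
  L′ : Layered (r ++ s)
  L′ = Layered-++ r s inc r≫s L
  pairs : AllPairs (λ b c → x ≤ c → x < b × b < c) (r ++ s)
  pairs = AllPairs.++⁺
    (AllPairs.map (λ (x<b , b<c) _ → x<b , b<c) (AllPairs.zip (All⇒AllPairsˡ x<r , inc)))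
    (AllPairs.map (λ c<x x≤c → contradiction x≤c (<⇒≱ c<x)) (All⇒AllPairsʳ s<x))
    (All.tabulate λ _ → All.map (λ c<x x≤c → contradiction x≤c (<⇒≱ c<x)) s<x)
  L″ : Layered (x ∷ r ++ s)
  L″ .distinct (_ ∷ʳ ab⊆)    = distinct L′ ab⊆
  L″ .distinct (refl ∷ b⊆)   = All.head (All-resp-⊆ b⊆
    (All.++⁺ (All.map <⇒≢ x<r) (All.map (≢-sym ∘ <⇒≢) s<x)))
  L″ .increasing (_ ∷ʳ abc⊆)  = increasing L′ abc⊆
  L″ .increasing (refl ∷ bc⊆) = AllPairs-lookup pairs bc⊆

Layered-concat : ∀ rs → Linked Descend rs → All IsInterval rs → All (Linked _<_) rs →
  Unique (concat rs) → Layered (concat rs)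
Layered-concat []       _ _        _           _ = λ where
  .distinct   ()
  .increasing ()
Layered-concat (r ∷ rs) l (I ∷ Is) (inc ∷ incs) u =
  Layered-++ r (concat rs) (Linked⇒AllPairs <-trans inc) (≫-concat r rs l (I ∷ Is) u)
    (Layered-concat rs (Linked.tail l) Is incs (proj₂ (AllPairs-++⁻ r u)))

ReverseLayered⇒Layered : ∀ π → Unique π → ReverseLayered π → Layered π
ReverseLayered⇒Layered π u I = subst Layered (concat-ascRuns π)
  (Layered-concat (ascRuns π) (ascRuns-descend π u) I (ascRuns-increasing π)
    (subst Unique (sym (concat-ascRuns π)) u))

-- Collecting the preimages over all cuts

IsPerm⇒length : ∀ {n π} → IsPerm n π → length π ≡ n
IsPerm⇒length {n} p = trans (↭-length p) (trans (length-map suc (upTo n)) (length-upTo n))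

IsPerm⇒Unique : ∀ {n π} → IsPerm n π → Unique π
IsPerm⇒Unique {n} p = Permutationₛ.Unique-resp-↭ (setoid ℕ) (↭⇒↭ₛ (↭-sym p))
  (Unique.map⁺ suc-injective (Unique.upTo⁺ n))

cut : List ℕ → ℕ → State
cut π k = drop k π , reverse (take k π)

contents-cut : ∀ π k → contents (cut π k) ≡ π
contents-cut π k = trans (ʳ++-defn (reverse (take k π)))
  (trans (cong (_++ drop k π) (reverse-involutive (take k π))) (take++drop≡id k π))

cut-contents : ∀ s q → cut (q ʳ++ s) (length q) ≡ (s , q)
cut-contents s q = begin
  cut (q ʳ++ s) (length q)
    ≡⟨ cong₂ cut (ʳ++-defn q) (sym (length-reverse q)) ⟩
  cut (reverse q ++ s) (length (reverse q))
    ≡⟨ cong₂ (λ s q → s , reverse q) (drop-++ (reverse q) s) (take-++ (reverse q) s) ⟩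
  s , reverse (reverse q)
    ≡⟨ cong (s ,_) (reverse-involutive q) ⟩
  s , q ∎
  where open ≡-Reasoning

length-cut : ∀ π k → k ≤ length π → length (proj₂ (cut π k)) ≡ k
length-cut π k k≤ =
  trans (length-reverse (take k π)) (trans (length-take k π) (m≤n⇒m⊓n≡m k≤))

length-concat-map : ∀ {a} {X : Set a} (f : ℕ → List X) ks →
  length (concat (map f ks)) ≡ sum (map (length ∘ f) ks)
length-concat-map f []       = refl
length-concat-map f (k ∷ ks) = trans (length-++ (f k)) (cong (length (f k) +_) (length-concat-map f ks))

inputsAt : List ℕ → ℕ → List (List ℕ)
inputsAt π k = let (s , q) = cut π k in inputs (length π) s q

inputsAt-unique : ∀ π k → Unique (inputsAt π k)
inputsAt-unique π k = let (s , q) = cut π k in inputs-unique (length π) s q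

inputsAt-sound : ∀ π k {ρ} → ρ ∈ inputsAt π k → load ρ ≡ cut π k
inputsAt-sound π k = let (s , q) = cut π k in inputs-sound (length π) s q

length-inputsAt : ∀ {π k} → Layered π → k ≤ length π →
  length (inputsAt π k) ≡ (dπ π k + aπ π k) C k
length-inputsAt {π} {k} L k≤ =
  let (s , q) = cut π k in
  subst₂ (λ ρ j → length (inputs (length ρ) s q) ≡ (dπ ρ j + aπ ρ j) C j)
    (contents-cut π k) (length-cut π k k≤)
    (length-inputs-cut q s (subst Layered (sym (contents-cut π k)) L))

-- A state with contents `π` is determined by its output length, any number from 0 to `length π`.
allInputs : List ℕ → List (List ℕ)
allInputs π = concat (map (inputsAt π) (upTo (suc (length π))))

∈-allInputs⁻ : ∀ π {ρ} → ρ ∈ allInputs π → contents (load ρ) ≡ π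
∈-allInputs⁻ π ρ∈ with ∈-concat⁻′ (map (inputsAt π) (upTo (suc (length π)))) ρ∈
... | _ , ρ∈′ , at∈ with ∈-map⁻ (inputsAt π) {xs = upTo (suc (length π))} at∈
...   | k , _ , refl = trans (cong contents (inputsAt-sound π k ρ∈′)) (contents-cut π k)

∈-allInputs⁺ : ∀ ρ → ρ ∈ allInputs (contents (load ρ))
∈-allInputs⁺ ρ = let (s , q) = load ρ ; π = contents (s , q) in
  ∈-concat⁺′
    (subst₂ (λ n (s , q) → ρ ∈ inputs n s q)
      (sym (↭-length (load-↭ ρ))) (sym (cut-contents s q)) (inputs-complete ρ))
    (∈-map⁺ (inputsAt π) (∈-upTo⁺
      (s≤s (subst (length q ≤_) (sym (length-ʳ++ q)) (m≤m+n (length q) (length s))))))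

-- An input has one final state, hence one output length, so the lists of different cuts are
-- disjoint.
allInputs-unique : ∀ π → Unique (allInputs π)
allInputs-unique π = Unique.concat⁺
  (All.map⁺ {xs = upTo (suc (length π))} (All.tabulate λ {k} _ → inputsAt-unique π k))
  (AllPairs.map⁺ {xs = upTo (suc (length π))} (AllPairs.applyUpTo⁺₁ id (suc (length π)) λ {i} {j} i<j j≤ (ρ∈ , ρ∈′) →
    <⇒≢ i<j (begin
      i                           ≡⟨ length-cut π i (<⇒≤ (<-≤-trans i<j (s≤s⁻¹ j≤))) ⟨
      length (proj₂ (cut π i))    ≡⟨ cong (length ∘ proj₂)
                                       (trans (sym (inputsAt-sound π i ρ∈)) (inputsAt-sound π j ρ∈′)) ⟩
      length (proj₂ (cut π j))    ≡⟨ length-cut π j (s≤s⁻¹ j≤) ⟩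
      j                           ∎)))
  where open ≡-Reasoning

length-allInputs : ∀ {π} → Layered π →
  length (allInputs π) ≡ sum0to (length π) (λ k → (dπ π k + aπ π k) C k)
length-allInputs {π} L = trans
  (length-concat-map (inputsAt π) (upTo (suc (length π))))
  (cong sum (map-cong-local (All.tabulate λ k∈ → length-inputsAt L (s≤s⁻¹ (∈-upTo⁻ k∈)))))

theorem4p7 : (n : ℕ) (π : List ℕ) → IsPerm n π → ReverseLayered π →
    Σ (List (List ℕ)) (λ L →
    Unique L
    × ((σ : List ℕ) → (σ ∈ L) ⇔ (IsPerm n σ × SC132 σ ≡ π))
    × length L ≡ sum0to n (λ k → (dπ π k + aπ π k) C k))
theorem4p7 n π perm layered =
    map reverse (allInputs π)
  , Unique.map⁺ reverse-injective (allInputs-unique π)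
  , (λ σ → mk⇔ sound (complete σ))
  , trans (length-map reverse (allInputs π))
      (subst (λ m → length (allInputs π) ≡ sum0to m (λ k → (dπ π k + aπ π k) C k))
        (IsPerm⇒length perm)
        (length-allInputs (ReverseLayered⇒Layered π (IsPerm⇒Unique perm) layered)))
  where
  sound : ∀ {σ} → σ ∈ map reverse (allInputs π) → IsPerm n σ × SC132 σ ≡ π
  sound σ∈ with ∈-map⁻ reverse σ∈
  ... | ρ , ρ∈ , refl =
      -- The machine only rearranges its input, so `σ` inherits `IsPerm n` from `π`.
      ↭-trans (↭-reverse ρ) (↭-trans (↭-sym (load-↭ ρ)) (subst (IsPerm n) (sym load≡) perm))
    , trans (SC132≡contents-load (reverse ρ))
        (trans (cong (contents ∘ load) (reverse-involutive ρ)) load≡)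
    where load≡ = ∈-allInputs⁻ π ρ∈
  complete : ∀ σ → IsPerm n σ × SC132 σ ≡ π → σ ∈ map reverse (allInputs π)
  complete σ (_ , refl) =
    subst₂ (λ τ ρ → τ ∈ map reverse (allInputs ρ))
      (reverse-involutive σ) (sym (SC132≡contents-load σ))
      (∈-map⁺ reverse (∈-allInputs⁺ (reverse σ)))
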